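{- Let $(\lambda(n))_{n=-\infty}^{n=\infty}$ be a strictly increasing sequence of real numbers such that $\lambda(n)\to\infty$ as $n\to\infty$ and $\lambda(n)\to-\infty$ as $n\to-\infty$. Let $f$ be a function on an interval $[a,b]$ such that $f$ is continuous from the left at every point of the sequence $(\lambda(n))$ with $a<\lambda(n)\le b$. Let $(c(n))$ be a complex sequence and let $S(t)=\sum_{\lambda_0<\lambda(n)\le t}c(n)$, where $\lambda_0$ is a fixed constant. Then $$\sum_{a<\lambda(n)\le b}c(n)f(\lambda(n))=\int_a^b f(t)\,dS(t)=f(b)S(b)-f(a)S(a)-\int_a^b S(t)\,df(t).$$
   Context: The integrals with respect to $dS$ and $df$ are Riemann–Stieltjes integrals.
   Formalization: For t < λ₀, S(t) is read as minus the sum of c(n) over t < λ(n) ≤ λ₀, since with an empty sum the claim fails when λ₀ > a; for λ₀ ≤ a nothing changes. The Riemann–Stieltjes integrals are limits along refinement of partitions, as the mesh limit may fail to exist. -}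

module Defs where

open import Level using (Level; _⊔_) renaming (suc to lsuc)
open import Algebra.Bundles using (CommutativeRing)
open import Algebra.Core using (Op₁; Op₂)
open import Algebra.Structures using (IsCommutativeRing)
open import Data.Integer.Base as ℤ using (ℤ)
import Data.Integer.Properties as ℤₚ
import Algebra.Properties.AbelianGroup ℤₚ.+-0-abelianGroup as ℤ+
import Data.Nat.Base as ℕ
open import Data.List.Base using (List; []; _∷_; filter; foldr; map; upTo)
open import Data.List.Membership.Propositional using (_∈_)
open import Data.List.Membership.Propositional.Properties
  using (∈-filter⁺; ∈-filter⁻; ∈-map⁺; ∈-upTo⁺)
import Data.List.Relation.Binary.Subset.Setoid as Subset
open import Data.List.Relation.Unary.Unique.Propositional using (Unique)
import Data.List.Relation.Unary.Unique.Propositional.Properties as Uniqueₚ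
open import Data.Product.Base using (Σ; ∃; _×_; _,_; proj₁; proj₂)
open import Data.Sum.Base using (inj₁; inj₂)
open import Relation.Binary.Core using (Rel)
open import Relation.Binary.PropositionalEquality.Core using (_≡_; sym; trans; cong; subst; subst₂)
open import Relation.Binary.Structures using (IsStrictTotalOrder)
import Relation.Binary.Construct.StrictToNonStrict as ToNonStrict
open import Relation.Nullary.Decidable.Core using (Dec; _×-dec_)
open import Relation.Nullary.Negation.Core using (¬_)
open import Relation.Unary using (Pred)

-- The real numbers, characterised up to isomorphism as a Dedekind-complete
-- ordered field.  The order is classical, i.e. trichotomous.
record CompleteOrderedField (c ℓ₁ ℓ₂ : Level) : Set (lsuc (c ⊔ ℓ₁ ⊔ ℓ₂)) where
  infix  8 -_
  infixl 7 _*_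
  infixl 6 _+_
  infix  4 _≈_ _<_
  field
    Carrier            : Set c
    _≈_                : Rel Carrier ℓ₁
    _<_                : Rel Carrier ℓ₂
    _+_ _*_            : Op₂ Carrier
    -_                 : Op₁ Carrier
    0# 1#              : Carrier
    isCommutativeRing  : IsCommutativeRing _≈_ _+_ _*_ -_ 0# 1#
    isStrictTotalOrder : IsStrictTotalOrder _≈_ _<_

  open ToNonStrict _≈_ _<_ public using (_≤_)

  UpperBound : Pred Carrier (c ⊔ ℓ₁ ⊔ ℓ₂) → Carrier → Set (c ⊔ ℓ₁ ⊔ ℓ₂)
  UpperBound P u = ∀ x → P x → x ≤ u

  field
    0<1       : 0# < 1#
    inverse   : ∀ x → ¬ x ≈ 0# → ∃ λ y → x * y ≈ 1#
    +-monoˡ-< : ∀ z {x y} → x < y → x + z < y + z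
    *-pos     : ∀ {x y} → 0# < x → 0# < y → 0# < x * y
    supremum  : ∀ P → ∃ P → ∃ (UpperBound P) →
                ∃ λ s → UpperBound P s × (∀ u → UpperBound P u → s ≤ u)

  commutativeRing : CommutativeRing c ℓ₁
  commutativeRing = record { isCommutativeRing = isCommutativeRing }

  open CommutativeRing commutativeRing public
    using (setoid; _-_)

  open IsStrictTotalOrder isStrictTotalOrder public
    using (compare; _<?_)

  _≤?_ : ∀ x y → Dec (x ≤ y)
  _≤?_ = ToNonStrict.decidable′ _≈_ _<_ compare

module Analysis {c ℓ₁ ℓ₂ : Level} (R : CompleteOrderedField c ℓ₁ ℓ₂) where

  open CompleteOrderedField R public renaming (Carrier to ℝ)

  record ℂ : Set c where
    constructor _+i_
    field
      re im : ℝ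

  open ℂ public

  infix  4 _≈ᶜ_
  infixl 6 _+ᶜ_ _-ᶜ_
  infixl 7 _*ᶜ_

  _≈ᶜ_ : Rel ℂ ℓ₁
  z ≈ᶜ w = (re z ≈ re w) × (im z ≈ im w)

  0ᶜ : ℂ
  0ᶜ = 0# +i 0#

  _+ᶜ_ _-ᶜ_ _*ᶜ_ : Op₂ ℂ
  z +ᶜ w = (re z + re w) +i (im z + im w)
  z -ᶜ w = (re z - re w) +i (im z - im w)
  z *ᶜ w = (re z * re w - im z * im w) +i (re z * im w + im z * re w)

  -- |z| < ε, squared so as not to mention the square root; the statements
  -- below only use it for ε > 0.
  ∣_∣<_ : ℂ → ℝ → Set ℓ₂
  ∣ z ∣< ε = re z * re z + im z * im z < ε * ε

  -- Functions on an interval are total functions ℝ → ℂ whose values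
  -- outside [a , b] are never constrained or used.
  WellDefinedOn : ℝ → ℝ → (ℝ → ℂ) → Set (c ⊔ ℓ₁ ⊔ ℓ₂)
  WellDefinedOn a b f = ∀ {x y} → a ≤ x → x ≤ b → a ≤ y → y ≤ b → x ≈ y → f x ≈ᶜ f y

  LeftContinuousAt : ℝ → ℝ → (ℝ → ℂ) → ℝ → Set (c ⊔ ℓ₁ ⊔ ℓ₂)
  LeftContinuousAt a b f x =
    ∀ ε → 0# < ε → ∃ λ δ → 0# < δ ×
      (∀ t → a ≤ t → t ≤ b → x - δ < t → t ≤ x → ∣ f t -ᶜ f x ∣< ε)

  -- Partitions a = t₀ ≤ t₁ ≤ … ≤ tₙ = b; repeated points are allowed and
  -- contribute nothing to Riemann–Stieltjes sums.
  infixr 5 _∷⟨_⟩_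

  data Partition : ℝ → ℝ → Set (c ⊔ ℓ₁ ⊔ ℓ₂) where
    [_]    : ∀ a → Partition a a
    _∷⟨_⟩_ : ∀ a {t b} → a ≤ t → Partition t b → Partition a b

  points : ∀ {a b} → Partition a b → List ℝ
  points [ a ]        = a ∷ []
  points (a ∷⟨ _ ⟩ P) = a ∷ points P

  -- Q ⊒ P : the partition Q refines P.
  _⊒_ : ∀ {a b} → Partition a b → Partition a b → Set (c ⊔ ℓ₁)
  Q ⊒ P = points P ⊆ points Q
    where open Subset setoid using (_⊆_)

  -- One tag ξᵢ ∈ [tᵢ₋₁ , tᵢ] for each subinterval.
  data Tags : ∀ {a b} → Partition a b → Set (c ⊔ ℓ₁ ⊔ ℓ₂) where
    []  : ∀ {a} → Tags [ a ]
    tag : ∀ {a t b} {a≤t : a ≤ t} {P : Partition t b} →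
          ∀ ξ → a ≤ ξ → ξ ≤ t → Tags P → Tags (a ∷⟨ a≤t ⟩ P)

  -- Σᵢ f(ξᵢ) (g(tᵢ) − g(tᵢ₋₁))
  rsSum : (f g : ℝ → ℂ) → ∀ {a b} {P : Partition a b} → Tags P → ℂ
  rsSum f g []                             = 0ᶜ
  rsSum f g (tag {a = s} {t = t} ξ _ _ ξs) = f ξ *ᶜ (g t -ᶜ g s) +ᶜ rsSum f g ξs

  -- ∫_a^b f dg exists and equals I.  The limit is taken along refinement of
  -- partitions, not as the mesh tends to 0: the mesh limit need not exist when
  -- f and g share a point of discontinuity, even if f is left-continuous and g
  -- right-continuous there.
  ∫[_,_]_d_≈_ : ℝ → ℝ → (f g : ℝ → ℂ) → ℂ → Set (c ⊔ ℓ₁ ⊔ ℓ₂)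
  ∫[ a , b ] f d g ≈ I =
    ∀ ε → 0# < ε → Σ (Partition a b) λ P →
      ∀ (Q : Partition a b) → Q ⊒ P → (ξs : Tags Q) → ∣ rsSum f g ξs -ᶜ I ∣< ε

  StrictlyIncreasing : (ℤ → ℝ) → Set ℓ₂
  StrictlyIncreasing Λ = ∀ {m n} → m ℤ.< n → Λ m < Λ n

  TendsTo+∞ : (ℤ → ℝ) → Set (c ⊔ ℓ₂)
  TendsTo+∞ Λ = ∀ M → ∃ λ N → ∀ n → N ℤ.≤ n → M < Λ n

  TendsTo-∞ : (ℤ → ℝ) → Set (c ⊔ ℓ₂)
  TendsTo-∞ Λ = ∀ M → ∃ λ N → ∀ n → n ℤ.≤ N → Λ n < M

  record Enumeration {p} (P : ℤ → Set p) : Set p where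
    field
      elements : List ℤ
      unique   : Unique elements
      sound    : ∀ {n} → n ∈ elements → P n
      complete : ∀ {n} → P n → n ∈ elements

  ∑[_] : ∀ {p} {P : ℤ → Set p} → Enumeration P → (ℤ → ℂ) → ℂ
  ∑[ E ] g = foldr (λ n z → g n +ᶜ z) 0ᶜ (Enumeration.elements E)

  module Sums (Λ : ℤ → ℝ) (Λ→+∞ : TendsTo+∞ Λ) (Λ→-∞ : TendsTo-∞ Λ) where

    private
      shift : ∀ m n → m ℤ.+ (n ℤ.- m) ≡ n
      shift m n = trans (ℤₚ.+-comm m (n ℤ.- m))
                 (trans (ℤₚ.+-assoc n (ℤ.- m) m)
                 (trans (cong (λ i → n ℤ.+ i) (ℤₚ.+-inverseˡ m)) (ℤₚ.+-identityʳ n)))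

      distance : ∀ {m n} → m ℤ.≤ n → ℤ.+ ℤ.∣ n ℤ.- m ∣ ≡ n ℤ.- m
      distance m≤n = ℤₚ.0≤i⇒+∣i∣≡i (ℤₚ.i≤j⇒0≤j-i m≤n)

      offset : ∀ {m n} → m ℤ.≤ n → m ℤ.+ ℤ.+ ℤ.∣ n ℤ.- m ∣ ≡ n
      offset {m} {n} m≤n = trans (cong (λ i → m ℤ.+ i) (distance m≤n)) (shift m n)

      offset-< : ∀ {m n k} → m ℤ.≤ n → n ℤ.< k → ℤ.∣ n ℤ.- m ∣ ℕ.< ℤ.∣ k ℤ.- m ∣
      offset-< {m} m≤n n<k = ℤₚ.drop‿+<+ (subst₂ ℤ._<_
        (sym (distance m≤n)) (sym (distance (ℤₚ.≤-trans m≤n (ℤₚ.<⇒≤ n<k))))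
        (ℤₚ.+-monoˡ-< (ℤ.- m) n<k))

    range : ∀ u v → Enumeration (λ n → (u < Λ n) × (Λ n ≤ v))
    range u v = record
      { elements = filter P? candidates
      ; unique   = Uniqueₚ.filter⁺ P? (Uniqueₚ.map⁺
                     (λ eq → ℤₚ.+-injective (ℤ+.∙-cancelˡ lo _ _ eq)) (Uniqueₚ.upTo⁺ ℤ.∣ hi ℤ.- lo ∣))
      ; sound    = λ n∈ → proj₂ (∈-filter⁻ P? {xs = candidates} n∈)
      ; complete = λ p → ∈-filter⁺ P? (candidate p) p
      }
      where
      open IsStrictTotalOrder isStrictTotalOrder using (asym; irrefl; module Eq)

      P? : ∀ n → Dec ((u < Λ n) × (Λ n ≤ v))
      P? n = (u <? Λ n) ×-dec (Λ n ≤? v)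

      lo hi : ℤ
      lo = proj₁ (Λ→-∞ u)
      hi = proj₁ (Λ→+∞ v)

      candidates : List ℤ
      candidates = map (λ k → lo ℤ.+ ℤ.+ k) (upTo ℤ.∣ hi ℤ.- lo ∣)

      ≤⇒≯ : ∀ {x y} → x ≤ y → ¬ (y < x)
      ≤⇒≯ (inj₁ x<y) y<x = asym x<y y<x
      ≤⇒≯ (inj₂ x≈y) y<x = irrefl (Eq.sym x≈y) y<x

      candidate : ∀ {n} → (u < Λ n) × (Λ n ≤ v) → n ∈ candidates
      candidate {n} (u<Λn , Λn≤v) =
        subst (_∈ candidates) (offset lo≤n) (∈-map⁺ _ (∈-upTo⁺ (offset-< lo≤n n<hi)))
        where
        lo≤n : lo ℤ.≤ n
        lo≤n = ℤₚ.≮⇒≥ λ n<lo → asym u<Λn (proj₂ (Λ→-∞ u) n (ℤₚ.<⇒≤ n<lo))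

        n<hi : n ℤ.< hi
        n<hi = ℤₚ.≰⇒> λ hi≤n → ≤⇒≯ Λn≤v (proj₂ (Λ→+∞ v) n hi≤n)

    -- ∑_{u < Λ n ≤ v} g n
    ∑⟨_<Λ≤_⟩ : ℝ → ℝ → (ℤ → ℂ) → ℂ
    ∑⟨ u <Λ≤ v ⟩ = ∑[ range u v ]

    -- The summatory function ∑_{λ₀ < Λ n ≤ t} g n, read for t < λ₀ with the usual
    -- orientation convention as − ∑_{t < Λ n ≤ λ₀} g n.  At least one of the two
    -- sums below is empty, and for λ₀ ≤ t it is the second.
    summatory : ℝ → (ℤ → ℂ) → ℝ → ℂ
    summatory λ₀ g t = ∑⟨ λ₀ <Λ≤ t ⟩ g -ᶜ ∑⟨ t <Λ≤ λ₀ ⟩ g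

{-# OPTIONS --safe #-}

-- On [a , b] the function S differs by a constant from the finite sum of the
-- step functions t ↦ c(n) [λ(n) ≤ t] with a < λ(n) ≤ b.  As soon as a partition
-- contains p and a point slightly below p, left continuity of f makes every
-- Riemann–Stieltjes sum of f against c [p ≤ t] close to c f(p); additivity then
-- gives ∫ f dS.  For the second integral, summation by parts turns a sum for
-- ∫ S df with points tᵢ and tags ξᵢ into a sum for ∫ f dS over the refinement
-- t₀ ≤ ξ₁ ≤ t₁ ≤ ξ₂ ≤ …, tagged by the tᵢ.
module Submission where

open import Defs
open import Algebra.Bundles using (CommutativeRing)
open import Algebra.Consequences.Setoid
  using (comm∧idˡ⇒id; comm∧invˡ⇒inv; comm∧distrˡ⇒distr)
import Algebra.Solver.Ring
open import Algebra.Solver.Ring.AlmostCommutativeRing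
  using (AlmostCommutativeRing; fromCommutativeRing; _-Raw-AlmostCommutative⟶_)
open import Data.Bool.Base using (if_then_else_)
open import Data.Integer.Base using (ℤ)
import Data.Integer.Base as ℤ
import Data.Integer.Properties as ℤₚ
open import Data.List.Base using (List; []; _∷_; foldr; filter)
open import Data.List.Membership.Propositional using (_∈_)
open import Data.List.Membership.Propositional.Properties using (∈-filter⁺; ∈-filter⁻)
open import Data.List.Membership.Propositional.Properties.WithK using (unique∧set⇒bag)
import Data.List.Membership.Setoid as Membership
open import Data.List.Membership.Setoid.Properties using (∈-resp-≈)
open import Data.List.Relation.Binary.BagAndSetEquality using (∼bag⇒↭)
open import Data.List.Relation.Binary.Permutation.Propositional as ↭ using (_↭_)
open import Data.List.Relation.Unary.All as All using (All; []; _∷_)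
open import Data.List.Relation.Unary.Any using (here; there)
import Data.List.Relation.Unary.Unique.Propositional.Properties as Unique
open import Data.Maybe.Base using (Maybe; just; nothing)
import Data.Nat.Base as ℕ
open import Data.Nat.Base using (suc; zero)
open import Data.Product.Base using (_×_; ∃₂; Σ; ∃; _,_; proj₁; proj₂)
open import Data.Sum.Base using (_⊎_; inj₁; inj₂)
open import Function.Base using (_∘_; id)
open import Function.Bundles using (mk⇔)
open import Relation.Binary.Bundles using (Setoid; StrictPartialOrder)
import Relation.Binary.Construct.StrictToNonStrict as ToNonStrict
open import Relation.Binary.Definitions using (tri<; tri≈; tri>)
import Relation.Binary.PropositionalEquality.Core as ≡
import Relation.Binary.Reasoning.StrictPartialOrder
open import Relation.Binary.Structures using (IsStrictTotalOrder)
open import Relation.Nullary using (¬_; does; yes; no; contradiction; _×-dec_)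
open import Relation.Unary using (Pred; Decidable)

-- A step c [p ≤ t] has its value c already at p itself, so on a partition through p its whole
-- increment falls on the subinterval that reaches p from the left. The tag there is at most p,
-- which is why one-sided continuity controls the error. The point slightly below p depends on p and
-- on the modulus of continuity there, so the finitely many jumps are treated one at a time, and
-- their partitions are merged when the integrals are added. Absolute values are available only as
-- squares; the bounds therefore come from ring identities with a nonnegative slack term instead of
-- the triangle inequality.

-- Integer coefficients have decidable equality, so normalisation recognises
-- cancellations x - x, which coefficients in an abstract ring would not allow.
module IntegerSolver {c ℓ} (R : CommutativeRing c ℓ) where
  open CommutativeRing R
  open import Algebra.Properties.Ring ring
    using (-‿distribˡ-*; -‿distribʳ-*; -0#≈0#; -‿involutive; -‿+-comm)
  open import Algebra.Properties.Semiring.Mult semiring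
    using (×-homo-+; ×1-homo-*) renaming (_×_ to _·_)
  open import Relation.Binary.Reasoning.Setoid setoid

  ⟦_⟧ᶻ : ℤ → Carrier
  ⟦ ℤ.+ n ⟧ᶻ      = n · 1#
  ⟦ ℤ.-[1+ n ] ⟧ᶻ = - (suc n · 1#)

  -- Addition of integers of opposite sign unfolds to `⊖`, so these are the cases of `+-homoᶻ` in
  -- which cancellation happens. The inductive step removes one `1#` from each side.
  ⟦⊖⟧ᶻ : ∀ m n → ⟦ m ℤ.⊖ n ⟧ᶻ ≈ m · 1# - n · 1#
  ⟦⊖⟧ᶻ zero    zero    = sym (-‿inverseʳ _)
  ⟦⊖⟧ᶻ zero    (suc n) = sym (+-identityˡ _)
  ⟦⊖⟧ᶻ (suc m) zero    = sym (trans (+-congˡ -0#≈0#) (+-identityʳ _))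
  ⟦⊖⟧ᶻ (suc m) (suc n) = begin
    ⟦ suc m ℤ.⊖ suc n ⟧ᶻ                 ≡⟨ ≡.cong ⟦_⟧ᶻ (ℤₚ.[1+m]⊖[1+n]≡m⊖n m n) ⟩
    ⟦ m ℤ.⊖ n ⟧ᶻ                         ≈⟨ ⟦⊖⟧ᶻ m n ⟩
    m · 1# - n · 1#                      ≈⟨ +-congʳ (+-identityʳ _) ⟨
    m · 1# + 0# - n · 1#                 ≈⟨ +-congʳ (+-congˡ (-‿inverseʳ 1#)) ⟨
    m · 1# + (1# - 1#) - n · 1#          ≈⟨ +-congʳ (+-assoc _ _ _) ⟨
    m · 1# + 1# - 1# - n · 1#            ≈⟨ +-congʳ (+-congʳ (+-comm _ _)) ⟩
    1# + m · 1# - 1# - n · 1#            ≈⟨ +-assoc _ _ _ ⟩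
    1# + m · 1# + (- 1# - n · 1#)        ≈⟨ +-congˡ (-‿+-comm _ _) ⟩
    1# + m · 1# - (1# + n · 1#)          ∎

  +-homoᶻ : ∀ i j → ⟦ i ℤ.+ j ⟧ᶻ ≈ ⟦ i ⟧ᶻ + ⟦ j ⟧ᶻ
  +-homoᶻ (ℤ.+ m)      (ℤ.+ n)      = ×-homo-+ 1# m n
  +-homoᶻ (ℤ.+ m)      ℤ.-[1+ n ]   = ⟦⊖⟧ᶻ m (suc n)
  +-homoᶻ ℤ.-[1+ m ]   (ℤ.+ n)      = trans (⟦⊖⟧ᶻ n (suc m)) (+-comm _ _)
  +-homoᶻ i@(ℤ.-[1+ m ]) j@(ℤ.-[1+ n ]) = begin
    ⟦ i ℤ.+ j ⟧ᶻ                  ≡⟨ ≡.cong ⟦_⟧ᶻ (ℤₚ.neg-distrib-+ (ℤ.+ suc m) (ℤ.+ suc n)) ⟨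
    - ((suc m ℕ.+ suc n) · 1#)    ≈⟨ -‿cong (×-homo-+ 1# (suc m) (suc n)) ⟩
    - (suc m · 1# + suc n · 1#)   ≈⟨ -‿+-comm _ _ ⟨
    ⟦ i ⟧ᶻ + ⟦ j ⟧ᶻ               ∎

  -‿homoᶻ : ∀ i → ⟦ ℤ.- i ⟧ᶻ ≈ - ⟦ i ⟧ᶻ
  -‿homoᶻ (ℤ.+ zero)  = sym -0#≈0#
  -‿homoᶻ (ℤ.+ suc n) = refl
  -‿homoᶻ ℤ.-[1+ n ]  = sym (-‿involutive _)

  *-homo⁺ : ∀ m j → ⟦ ℤ.+ m ℤ.* j ⟧ᶻ ≈ m · 1# * ⟦ j ⟧ᶻ
  *-homo⁺ m (ℤ.+ n) = begin
    ⟦ ℤ.+ m ℤ.* ℤ.+ n ⟧ᶻ               ≡⟨ ≡.cong ⟦_⟧ᶻ (ℤₚ.pos-* m n) ⟨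
    (m ℕ.* n) · 1#                     ≈⟨ ×1-homo-* m n ⟩
    m · 1# * n · 1#                    ∎
  *-homo⁺ m ℤ.-[1+ n ] = begin
    ⟦ ℤ.+ m ℤ.* ℤ.-[1+ n ] ⟧ᶻ          ≡⟨ ≡.cong ⟦_⟧ᶻ (ℤₚ.neg-distribʳ-* (ℤ.+ m) (ℤ.+ suc n)) ⟨
    ⟦ ℤ.- (ℤ.+ m ℤ.* ℤ.+ suc n) ⟧ᶻ     ≈⟨ -‿homoᶻ (ℤ.+ m ℤ.* ℤ.+ suc n) ⟩
    - ⟦ ℤ.+ m ℤ.* ℤ.+ suc n ⟧ᶻ         ≈⟨ -‿cong (*-homo⁺ m (ℤ.+ suc n)) ⟩
    - (m · 1# * suc n · 1#)            ≈⟨ -‿distribʳ-* _ _ ⟩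
    m · 1# * ⟦ ℤ.-[1+ n ] ⟧ᶻ           ∎

  *-homoᶻ : ∀ i j → ⟦ i ℤ.* j ⟧ᶻ ≈ ⟦ i ⟧ᶻ * ⟦ j ⟧ᶻ
  *-homoᶻ (ℤ.+ m)    j = *-homo⁺ m j
  *-homoᶻ ℤ.-[1+ m ] j = begin
    ⟦ ℤ.-[1+ m ] ℤ.* j ⟧ᶻ              ≡⟨ ≡.cong ⟦_⟧ᶻ (ℤₚ.neg-distribˡ-* (ℤ.+ suc m) j) ⟨
    ⟦ ℤ.- (ℤ.+ suc m ℤ.* j) ⟧ᶻ         ≈⟨ -‿homoᶻ (ℤ.+ suc m ℤ.* j) ⟩
    - ⟦ ℤ.+ suc m ℤ.* j ⟧ᶻ             ≈⟨ -‿cong (*-homo⁺ (suc m) j) ⟩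
    - (suc m · 1# * ⟦ j ⟧ᶻ)            ≈⟨ -‿distribˡ-* _ _ ⟩
    ⟦ ℤ.-[1+ m ] ⟧ᶻ * ⟦ j ⟧ᶻ           ∎

  almostCommutativeRing : AlmostCommutativeRing c ℓ
  almostCommutativeRing = fromCommutativeRing R

  morphism : ℤ.+-*-rawRing -Raw-AlmostCommutative⟶ almostCommutativeRing
  morphism = record
    { ⟦_⟧    = ⟦_⟧ᶻ
    ; +-homo = +-homoᶻ
    ; *-homo = *-homoᶻ
    ; -‿homo = -‿homoᶻ
    ; 0-homo = refl
    ; 1-homo = +-identityʳ 1#
    }

  _≟ᶻ_ : ∀ i j → Maybe (⟦ i ⟧ᶻ ≈ ⟦ j ⟧ᶻ)
  i ≟ᶻ j with i ℤₚ.≟ j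
  ... | yes i≡j = just (reflexive (≡.cong ⟦_⟧ᶻ i≡j))
  ... | no  _   = nothing

  open Algebra.Solver.Ring ℤ.+-*-rawRing almostCommutativeRing morphism _≟ᶻ_ public
    using (solve; _:=_; _:+_; _:*_; _:-_; :-_)

-- Order and arithmetic of the real numbers.

module OrderedFieldProperties {c ℓ₁ ℓ₂} (R : CompleteOrderedField c ℓ₁ ℓ₂) where
  open CompleteOrderedField R
  open CommutativeRing commutativeRing public
    using (+-cong; +-congˡ; +-congʳ; +-comm; +-identityˡ; +-identityʳ; -‿inverseʳ
          ; *-cong; *-congˡ; *-congʳ; *-comm; *-identityʳ; zeroʳ)
    renaming (refl to ≈-refl; sym to ≈-sym; trans to ≈-trans)
  open IsStrictTotalOrder isStrictTotalOrder public
    using (isStrictPartialOrder; <-respʳ-≈; <-respˡ-≈)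
    renaming (trans to <-trans; asym to <-asym; irrefl to <-irrefl)
  open IntegerSolver commutativeRing public

  private module ≤ = ToNonStrict _≈_ _<_
  open IsStrictTotalOrder isStrictTotalOrder using (isEquivalence; <-resp-≈)

  <⇒≤ : ∀ {x y} → x < y → x ≤ y
  <⇒≤ = inj₁

  ≈⇒≤ : ∀ {x y} → x ≈ y → x ≤ y
  ≈⇒≤ = inj₂

  ≤-refl : ∀ {x} → x ≤ x
  ≤-refl = inj₂ ≈-refl

  ≤-trans : ∀ {x y z} → x ≤ y → y ≤ z → x ≤ z
  ≤-trans = ≤.trans isEquivalence <-resp-≈ <-trans

  ≤-antisym : ∀ {x y} → x ≤ y → y ≤ x → x ≈ y
  ≤-antisym = ≤.antisym isEquivalence <-trans <-irrefl

  <-≤-trans : ∀ {x y z} → x < y → y ≤ z → x < z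
  <-≤-trans = ≤.<-≤-trans <-trans <-respʳ-≈

  ≤-<-trans : ∀ {x y z} → x ≤ y → y < z → x < z
  ≤-<-trans = ≤.≤-<-trans ≈-sym <-trans <-respˡ-≈

  <⇒≱ : ∀ {x y} → x < y → ¬ y ≤ x
  <⇒≱ x<y y≤x = <-irrefl ≈-refl (<-≤-trans x<y y≤x)

  ≰⇒> : ∀ {x y} → ¬ x ≤ y → y < x
  ≰⇒> {x} {y} x≰y with compare x y
  ... | tri< x<y _ _ = contradiction (<⇒≤ x<y) x≰y
  ... | tri≈ _ x≈y _ = contradiction (≈⇒≤ x≈y) x≰y
  ... | tri> _ _ y<x = y<x

  ≤-<-connex : ∀ x y → x ≤ y ⊎ y < x
  ≤-<-connex x y with x ≤? y
  ... | yes x≤y = inj₁ x≤y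
  ... | no  x≰y = inj₂ (≰⇒> x≰y)

  <-strictPartialOrder : StrictPartialOrder c ℓ₁ ℓ₂
  <-strictPartialOrder = record { isStrictPartialOrder = isStrictPartialOrder }

  module ≤-Reasoning = Relation.Binary.Reasoning.StrictPartialOrder <-strictPartialOrder

  open ≤-Reasoning

  +-monoʳ-< : ∀ z {x y} → x < y → z + x < z + y
  +-monoʳ-< z {x} {y} x<y = begin-strict
    z + x  ≈⟨ +-comm z x ⟩
    x + z  <⟨ +-monoˡ-< z x<y ⟩
    y + z  ≈⟨ +-comm y z ⟩
    z + y  ∎

  +-mono-< : ∀ {w x y z} → w < x → y < z → w + y < x + z
  +-mono-< w<x y<z = <-trans (+-monoˡ-< _ w<x) (+-monoʳ-< _ y<z)

  +-monoʳ-≤ : ∀ z {x y} → x ≤ y → z + x ≤ z + y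
  +-monoʳ-≤ z (inj₁ x<y) = <⇒≤ (+-monoʳ-< z x<y)
  +-monoʳ-≤ z (inj₂ x≈y) = ≈⇒≤ (+-congˡ x≈y)

  x≤x+y : ∀ {x y} → 0# ≤ y → x ≤ x + y
  x≤x+y {x} {y} 0≤y = begin
    x       ≈⟨ +-identityʳ x ⟨
    x + 0#  ≤⟨ +-monoʳ-≤ x 0≤y ⟩
    x + y   ∎

  +-nonneg : ∀ {x y} → 0# ≤ x → 0# ≤ y → 0# ≤ x + y
  +-nonneg 0≤x 0≤y = ≤-trans 0≤x (x≤x+y 0≤y)

  x<y⇒0<y-x : ∀ {x y} → x < y → 0# < y - x
  x<y⇒0<y-x {x} x<y = <-respˡ-≈ (-‿inverseʳ x) (+-monoˡ-< (- x) x<y)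

  x-y<x : ∀ {x y} → 0# < y → x - y < x
  x-y<x {x} {y} 0<y = begin-strict
    x - y        ≈⟨ +-identityʳ (x - y) ⟨
    x - y + 0#   <⟨ +-monoʳ-< (x - y) 0<y ⟩
    x - y + y    ≈⟨ solve 2 (λ x y → x :- y :+ y := x) ≈-refl x y ⟩
    x            ∎

  *-nonneg : ∀ {x y} → 0# ≤ x → 0# ≤ y → 0# ≤ x * y
  *-nonneg     (inj₁ 0<x) (inj₁ 0<y) = <⇒≤ (*-pos 0<x 0<y)
  *-nonneg {x} _          (inj₂ 0≈y) = ≈⇒≤ (≈-trans (≈-sym (zeroʳ x)) (*-congˡ 0≈y))
  *-nonneg {y = y} (inj₂ 0≈x) _      =
    ≈⇒≤ (≈-trans (≈-sym (≈-trans (*-comm 0# y) (zeroʳ y))) (*-congʳ 0≈x))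

  *-monoʳ-<-pos : ∀ {z} → 0# < z → ∀ {x y} → x < y → z * x < z * y
  *-monoʳ-<-pos {z} 0<z {x} {y} x<y = begin-strict
    z * x                ≈⟨ +-identityʳ (z * x) ⟨
    z * x + 0#           <⟨ +-monoʳ-< (z * x) (*-pos 0<z (x<y⇒0<y-x x<y)) ⟩
    z * x + z * (y - x)  ≈⟨ solve 3 (λ x y z → z :* x :+ z :* (y :- x) := z :* y) ≈-refl x y z ⟩
    z * y                ∎

  0≤x*x : ∀ x → 0# ≤ x * x
  0≤x*x x with compare x 0#
  ... | tri> _ _ 0<x = <⇒≤ (*-pos 0<x 0<x)
  ... | tri≈ _ x≈0 _ = ≈⇒≤ (≈-sym (≈-trans (*-congˡ x≈0) (zeroʳ x)))
  ... | tri< x<0 _ _ = begin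
    0#                       <⟨ *-pos (x<y⇒0<y-x x<0) (x<y⇒0<y-x x<0) ⟩
    (0# - x) * (0# - x)      ≈⟨ *-cong (+-identityˡ (- x)) (+-identityˡ (- x)) ⟩
    - x * - x                ≈⟨ solve 1 (λ x → (:- x) :* (:- x) := x :* x) ≈-refl x ⟩
    x * x                    ∎

  ∃-quotient : ∀ {x y} → 0# < x → 0# < y → ∃ λ z → 0# < z × x * z ≈ y
  ∃-quotient {x} {y} 0<x 0<y with inverse x (λ x≈0 → <-irrefl (≈-sym x≈0) 0<x)
  ... | x⁻¹ , xx⁻¹≈1 = x⁻¹ * y , ≰⇒> z≰0 , xz≈y
    where
    xz≈y : x * (x⁻¹ * y) ≈ y
    xz≈y = begin-equality
      x * (x⁻¹ * y)  ≈⟨ solve 3 (λ x x⁻¹ y → x :* (x⁻¹ :* y) := y :* (x :* x⁻¹)) ≈-refl x x⁻¹ y ⟩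
      y * (x * x⁻¹)  ≈⟨ *-congˡ xx⁻¹≈1 ⟩
      y * 1#         ≈⟨ *-identityʳ y ⟩
      y              ∎

    -- The sign of `x⁻¹` is never determined: a nonpositive quotient times the positive `x` would be
    -- nonpositive, yet this product is `y`.
    z≰0 : ¬ x⁻¹ * y ≤ 0#
    z≰0 (inj₁ z<0) = <-asym 0<y (<-respˡ-≈ xz≈y (<-respʳ-≈ (zeroʳ x) (*-monoʳ-<-pos 0<x z<0)))
    z≰0 (inj₂ z≈0) = <-irrefl (≈-trans (≈-sym (zeroʳ x)) (≈-trans (*-congˡ (≈-sym z≈0)) xz≈y)) 0<y

  ∃-half : ∀ {ε} → 0# < ε → ∃ λ η → 0# < η × η + η ≈ ε
  ∃-half 0<ε with ∃-quotient (<-trans 0<1 1<2) 0<ε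
    where
    1<2 : 1# < 1# + 1#
    1<2 = <-respˡ-≈ (+-identityʳ 1#) (+-monoʳ-< 1# 0<1)
  ... | η , 0<η , 2η≈ε = η , 0<η , ≈-trans η+η≈2η 2η≈ε
    where
    η+η≈2η : η + η ≈ (1# + 1#) * η
    η+η≈2η = begin-equality
      η + η            ≈⟨ +-cong (*-identityʳ η) (*-identityʳ η) ⟨
      η * 1# + η * 1#  ≈⟨ solve 2 (λ η u → η :* u :+ η :* u := (u :+ u) :* η) ≈-refl η 1# ⟩
      (1# + 1#) * η    ∎

  dense : ∀ {x y} → x < y → ∃ λ z → x < z × z < y
  dense {x} {y} x<y with ∃-half (x<y⇒0<y-x x<y)
  ... | η , 0<η , 2η≈y-x = x + η , <-respˡ-≈ (+-identityʳ x) (+-monoʳ-< x 0<η) , (begin-strict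
    x + η        ≈⟨ +-identityʳ (x + η) ⟨
    x + η + 0#   <⟨ +-monoʳ-< (x + η) 0<η ⟩
    x + η + η    ≈⟨ solve 2 (λ x η → x :+ η :+ η := x :+ (η :+ η)) ≈-refl x η ⟩
    x + (η + η)  ≈⟨ +-congˡ 2η≈y-x ⟩
    x + (y - x)  ≈⟨ solve 2 (λ x y → x :+ (y :- x) := y) ≈-refl x y ⟩
    y            ∎)

-- The complex numbers as a commutative ring, and estimates for the modulus.

module ComplexProperties {c ℓ₁ ℓ₂} (R : CompleteOrderedField c ℓ₁ ℓ₂) where
  open Analysis R
  open OrderedFieldProperties R
  open ≤-Reasoning

  1ᶜ : ℂ
  1ᶜ = 1# +i 0#

  -ᶜ_ : ℂ → ℂ
  -ᶜ z = (- re z) +i (- im z)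

  private
    ℂ-setoid : Setoid c ℓ₁
    ℂ-setoid = record
      { Carrier       = ℂ
      ; _≈_           = _≈ᶜ_
      ; isEquivalence = record
        { refl  = ≈-refl , ≈-refl
        ; sym   = λ (p , q) → ≈-sym p , ≈-sym q
        ; trans = λ (p , q) (p′ , q′) → ≈-trans p p′ , ≈-trans q q′
        }
      }

    +ᶜ-cong : ∀ {u v w z} → u ≈ᶜ v → w ≈ᶜ z → u +ᶜ w ≈ᶜ v +ᶜ z
    +ᶜ-cong (p , q) (p′ , q′) = +-cong p p′ , +-cong q q′

    +ᶜ-comm : ∀ z w → z +ᶜ w ≈ᶜ w +ᶜ z
    +ᶜ-comm z w = +-comm _ _ , +-comm _ _

    *ᶜ-comm : ∀ z w → z *ᶜ w ≈ᶜ w *ᶜ z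
    *ᶜ-comm (x +i y) (u +i v) =
        solve 4 (λ x y u v → x :* u :- y :* v := u :* x :- v :* y) ≈-refl x y u v
      , solve 4 (λ x y u v → x :* v :+ y :* u := u :* y :+ v :* x) ≈-refl x y u v

    *ᶜ-cong : ∀ {u v w z} → u ≈ᶜ v → w ≈ᶜ z → u *ᶜ w ≈ᶜ v *ᶜ z
    *ᶜ-cong (p , q) (p′ , q′) =
        +-cong (*-cong p p′) (-‿cong (*-cong q q′))
      , +-cong (*-cong p q′) (*-cong q p′)
      where open CommutativeRing commutativeRing using (-‿cong)

    *ᶜ-assoc : ∀ w z z′ → (w *ᶜ z) *ᶜ z′ ≈ᶜ w *ᶜ (z *ᶜ z′)
    *ᶜ-assoc (x +i y) (u +i v) (s +i t) =
        solve 6 (λ x y u v s t → (x :* u :- y :* v) :* s :- (x :* v :+ y :* u) :* t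
          := x :* (u :* s :- v :* t) :- y :* (u :* t :+ v :* s)) ≈-refl x y u v s t
      , solve 6 (λ x y u v s t → (x :* u :- y :* v) :* t :+ (x :* v :+ y :* u) :* s
          := x :* (u :* t :+ v :* s) :+ y :* (u :* s :- v :* t)) ≈-refl x y u v s t

    *ᶜ-distribˡ-+ᶜ : ∀ w z z′ → w *ᶜ (z +ᶜ z′) ≈ᶜ w *ᶜ z +ᶜ w *ᶜ z′
    *ᶜ-distribˡ-+ᶜ (x +i y) (u +i v) (s +i t) =
        solve 6 (λ x y u v s t → x :* (u :+ s) :- y :* (v :+ t)
          := (x :* u :- y :* v) :+ (x :* s :- y :* t)) ≈-refl x y u v s t
      , solve 6 (λ x y u v s t → x :* (v :+ t) :+ y :* (u :+ s)
          := (x :* v :+ y :* u) :+ (x :* t :+ y :* s)) ≈-refl x y u v s t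

    *ᶜ-identityˡ : ∀ z → 1ᶜ *ᶜ z ≈ᶜ z
    *ᶜ-identityˡ (x +i y) =
        (begin-equality
          1# * x - 0# * y  ≈⟨ +-cong (*-identityˡ x) (-‿cong (zeroˡ y)) ⟩
          x - 0#           ≈⟨ +-congˡ -0#≈0# ⟩
          x + 0#           ≈⟨ +-identityʳ x ⟩
          x                ∎)
      , (begin-equality
          1# * y + 0# * x  ≈⟨ +-cong (*-identityˡ y) (zeroˡ x) ⟩
          y + 0#           ≈⟨ +-identityʳ y ⟩
          y                ∎)
      where
      open CommutativeRing commutativeRing using (-‿cong; zeroˡ; *-identityˡ; ring)
      open import Algebra.Properties.Ring ring using (-0#≈0#)

  ℂ-commutativeRing : CommutativeRing c ℓ₁
  ℂ-commutativeRing = record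
    { Carrier = ℂ
    ; _≈_ = _≈ᶜ_
    ; _+_ = _+ᶜ_
    ; _*_ = _*ᶜ_
    ; -_ = -ᶜ_
    ; 0# = 0ᶜ
    ; 1# = 1ᶜ
    ; isCommutativeRing = record
      { isRing = record
        { +-isAbelianGroup = record
          { isGroup = record
            { isMonoid = record
              { isSemigroup = record
                { isMagma = record
                  { isEquivalence = Setoid.isEquivalence ℂ-setoid
                  ; ∙-cong = +ᶜ-cong
                  }
                ; assoc = λ _ _ _ → +-assoc _ _ _ , +-assoc _ _ _
                }
              ; identity = comm∧idˡ⇒id ℂ-setoid +ᶜ-comm λ _ → +-identityˡ _ , +-identityˡ _
              }
            ; inverse = comm∧invˡ⇒inv ℂ-setoid +ᶜ-comm λ _ → -‿inverseˡ _ , -‿inverseˡ _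
            ; ⁻¹-cong = λ (p , q) → -‿cong p , -‿cong q
            }
          ; comm = +ᶜ-comm
          }
        ; *-cong = *ᶜ-cong
        ; *-assoc = *ᶜ-assoc
        ; *-identity = comm∧idˡ⇒id ℂ-setoid *ᶜ-comm *ᶜ-identityˡ
        ; distrib = comm∧distrˡ⇒distr ℂ-setoid +ᶜ-cong *ᶜ-comm *ᶜ-distribˡ-+ᶜ
        }
      ; *-comm = *ᶜ-comm
      }
    }
    where open CommutativeRing commutativeRing using (+-assoc; -‿inverseˡ; -‿cong)

  z-0≈z : ∀ z → z -ᶜ 0ᶜ ≈ᶜ z
  z-0≈z z = C.trans (C.+-congˡ -0#≈0#) (C.+-identityʳ z)
    where
    module C = CommutativeRing ℂ-commutativeRing
    open import Algebra.Properties.Ring C.ring using (-0#≈0#)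

  ∣_∣² : ℂ → ℝ
  ∣ z ∣² = re z * re z + im z * im z

  0≤∣_∣² : ∀ z → 0# ≤ ∣ z ∣²
  0≤∣ z ∣² = +-nonneg (0≤x*x (re z)) (0≤x*x (im z))

  ∣∣<-resp-≈ᶜ : ∀ {z w ε} → z ≈ᶜ w → ∣ z ∣< ε → ∣ w ∣< ε
  ∣∣<-resp-≈ᶜ (p , q) = <-respˡ-≈ (+-cong (*-cong p p) (*-cong q q))

  ∣∣<-resp-≈ : ∀ {z ε η} → ε ≈ η → ∣ z ∣< ε → ∣ z ∣< η
  ∣∣<-resp-≈ p = <-respʳ-≈ (*-cong p p)

  ∣0∣< : ∀ {ε} → 0# < ε → ∣ 0ᶜ ∣< ε
  ∣0∣< {ε} 0<ε = begin-strict
    0# * 0# + 0# * 0#  ≈⟨ +-cong (zeroʳ 0#) (zeroʳ 0#) ⟩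
    0# + 0#            ≈⟨ +-identityʳ 0# ⟩
    0#                 <⟨ *-pos 0<ε 0<ε ⟩
    ε * ε              ∎

  ∣-∣< : ∀ {z ε} → ∣ z ∣< ε → ∣ -ᶜ z ∣< ε
  ∣-∣< {z} = <-respˡ-≈
    (solve 2 (λ x y → x :* x :+ y :* y := (:- x) :* (:- x) :+ (:- y) :* (:- y)) ≈-refl (re z) (im z))

  -- From the parallelogram law: ∣z + w∣² ≤ 2 ∣z∣² + 2 ∣w∣² < (2 η)².
  ∣+∣< : ∀ {z w η} → ∣ z ∣< η → ∣ w ∣< η → ∣ z +ᶜ w ∣< (η + η)
  ∣+∣< {z@(x +i y)} {w@(u +i v)} {η} ∣z∣<η ∣w∣<η = begin-strict
    ∣ z +ᶜ w ∣²                              ≤⟨ x≤x+y (0≤∣ z -ᶜ w ∣²) ⟩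
    ∣ z +ᶜ w ∣² + ∣ z -ᶜ w ∣²                ≈⟨ solve 4 (λ x y u v →
        (x :+ u) :* (x :+ u) :+ (y :+ v) :* (y :+ v) :+ ((x :- u) :* (x :- u) :+ (y :- v) :* (y :- v))
        := (x :* x :+ y :* y :+ (u :* u :+ v :* v)) :+ (x :* x :+ y :* y :+ (u :* u :+ v :* v)))
        ≈-refl x y u v ⟩
    (∣ z ∣² + ∣ w ∣²) + (∣ z ∣² + ∣ w ∣²)    <⟨ +-mono-< z+w<2η² z+w<2η² ⟩
    (η * η + η * η) + (η * η + η * η)        ≈⟨ solve 1 (λ η →
        (η :* η :+ η :* η) :+ (η :* η :+ η :* η) := (η :+ η) :* (η :+ η)) ≈-refl η ⟩
    (η + η) * (η + η)                        ∎
    where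
    z+w<2η² : ∣ z ∣² + ∣ w ∣² < η * η + η * η
    z+w<2η² = +-mono-< ∣z∣<η ∣w∣<η

  -- The choice is δ = ε / D with D = 1 + ∣w∣². Since ∣w∣² ≤ D², this D bounds ∣w∣ without a square
  -- root, and it is positive even for w = 0, so it can be divided by.
  *ᶜ-continuous : ∀ w {ε} → 0# < ε → ∃ λ δ → 0# < δ × (∀ z → ∣ z ∣< δ → ∣ z *ᶜ w ∣< ε)
  *ᶜ-continuous w@(u +i v) {ε} 0<ε = δ , 0<δ , bound
    where
    C D : ℝ
    C = ∣ w ∣²
    D = 1# + C

    0<D : 0# < D
    0<D = <-≤-trans 0<1 (x≤x+y (0≤∣ w ∣²))

    δ,0<δ,Dδ≈ε = ∃-quotient 0<D 0<ε
    δ    = proj₁ δ,0<δ,Dδ≈ε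
    0<δ  = proj₁ (proj₂ δ,0<δ,Dδ≈ε)
    Dδ≈ε = proj₂ (proj₂ δ,0<δ,Dδ≈ε)

    -- Rests on (1 + C)² - C = 1 + C + C². The unit enters the solver as a variable `u`, hence the
    -- padding by factors `1#`.
    0≤DD-C : 0# ≤ D * D - C
    0≤DD-C = begin
      0#                            ≤⟨ +-nonneg (<⇒≤ 0<1) (+-nonneg (0≤∣ w ∣²) (0≤x*x C)) ⟩
      1# + (C + C * C)              ≈⟨ +-cong (*-identityʳ 1#) (+-congʳ (*-identityʳ C)) ⟨
      1# * 1# + (C * 1# + C * C)    ≈⟨ solve 2 (λ u C → u :* u :+ (C :* u :+ C :* C)
                                         := (u :+ C) :* (u :+ C) :- C :* u) ≈-refl 1# C ⟩
      D * D - C * 1#                ≈⟨ +-congˡ (-‿cong (*-identityʳ C)) ⟩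
      D * D - C                     ∎
      where open CommutativeRing commutativeRing using (-‿cong)

    bound : ∀ z → ∣ z ∣< δ → ∣ z *ᶜ w ∣< ε
    bound z@(x +i y) ∣z∣<δ = begin-strict
      -- As ∣z w∣² = ∣z∣² ∣w∣², the added slack completes this to D² ∣z∣².
      ∣ z *ᶜ w ∣²                              ≤⟨ x≤x+y (*-nonneg (0≤∣ z ∣²) 0≤DD-C) ⟩
      ∣ z *ᶜ w ∣² + ∣ z ∣² * (D * D - C)       ≈⟨ solve 5 (λ x y u v D →
          (x :* u :- y :* v) :* (x :* u :- y :* v) :+ (x :* v :+ y :* u) :* (x :* v :+ y :* u)
            :+ (x :* x :+ y :* y) :* (D :* D :- (u :* u :+ v :* v))
          := (D :* D) :* (x :* x :+ y :* y)) ≈-refl x y u v D ⟩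
      (D * D) * ∣ z ∣²                         <⟨ *-monoʳ-<-pos (*-pos 0<D 0<D) ∣z∣<δ ⟩
      (D * D) * (δ * δ)                        ≈⟨ solve 2 (λ D δ → (D :* D) :* (δ :* δ)
                                                    := (D :* δ) :* (D :* δ)) ≈-refl D δ ⟩
      (D * δ) * (D * δ)                        ≈⟨ *-cong Dδ≈ε Dδ≈ε ⟩
      ε * ε                                    ∎

module StieltjesIntegral {c ℓ₁ ℓ₂} (R : CompleteOrderedField c ℓ₁ ℓ₂) where
  open Analysis R
  open OrderedFieldProperties R
    using (≈-refl; ≈-sym; ≤-refl; ≤-trans; <⇒≤; ≈⇒≤; ≤-antisym; <-≤-trans; <⇒≱; ≤-<-connex; <-irrefl
          ; x-y<x; ∃-half; dense)
  open ComplexProperties R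
  open CommutativeRing ℂ-commutativeRing
    using (+-cong; +-congˡ; +-congʳ; *-congˡ; -‿cong; +-identityˡ; +-identityʳ; -‿inverseʳ; zeroʳ)
    renaming (refl to ≈ᶜ-refl; sym to ≈ᶜ-sym; trans to ≈ᶜ-trans; setoid to ℂ-setoid)
  open IntegerSolver ℂ-commutativeRing
  open Membership setoid using () renaming (_∈_ to _∈ᴿ_)
  open import Relation.Binary.Reasoning.Setoid ℂ-setoid

  -- Partitions and their common refinements.

  partition-≤ : ∀ {a b} → Partition a b → a ≤ b
  partition-≤ [ _ ]          = ≤-refl
  partition-≤ (_ ∷⟨ a≤t ⟩ P) = ≤-trans a≤t (partition-≤ P)

  points-≥ : ∀ {a b x} (P : Partition a b) → x ∈ᴿ points P → a ≤ x
  points-≥ [ _ ]          (here x≈a) = ≈⇒≤ (≈-sym x≈a)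
  points-≥ (_ ∷⟨ _ ⟩ _)   (here x≈a) = ≈⇒≤ (≈-sym x≈a)
  points-≥ (_ ∷⟨ a≤t ⟩ P) (there x∈) = ≤-trans a≤t (points-≥ P x∈)

  insert : ∀ {a b x} → a ≤ x → x ≤ b → (P : Partition a b) →
           Σ (Partition a b) λ Q → Q ⊒ P × x ∈ᴿ points Q
  insert a≤x x≤a [ a ] = [ a ] , id , here (≤-antisym x≤a a≤x)
  insert {x = x} a≤x x≤b (_∷⟨_⟩_ a {t} a≤t P) with ≤-<-connex x t
  ... | inj₁ x≤t = a ∷⟨ a≤x ⟩ x ∷⟨ x≤t ⟩ P
                , (λ { (here p) → here p ; (there p) → there (there p) })
                , there (here ≈-refl)
  ... | inj₂ t<x with insert (<⇒≤ (t<x)) x≤b P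
  ...   | Q , Q⊒P , x∈Q = a ∷⟨ a≤t ⟩ Q
                        , (λ { (here p) → here p ; (there p) → there (Q⊒P p) })
                        , there x∈Q

  -- The points of `P` are inserted one by one. `P` may start at any `s` above `a` because the
  -- recursion strips its first points while the other partition keeps its full extent.
  merge : ∀ {a s b} → a ≤ s → (P : Partition s b) (Q : Partition a b) →
          Σ (Partition a b) λ T → (∀ {x} → x ∈ᴿ points P → x ∈ᴿ points T) × T ⊒ Q
  merge a≤s [ s ] Q with insert a≤s ≤-refl Q
  ... | T , T⊒Q , s∈T = T , (λ { (here x≈s) → ∈-resp-≈ setoid (≈-sym x≈s) s∈T }) , T⊒Q
  merge a≤s (s ∷⟨ s≤t ⟩ P) Q with merge (≤-trans a≤s s≤t) P Q
  ... | T , P⊆T , T⊒Q with insert a≤s (≤-trans s≤t (partition-≤ P)) T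
  ...   | U , U⊒T , s∈U = U
                        , (λ { (here x≈s) → ∈-resp-≈ setoid (≈-sym x≈s) s∈U ; (there x∈P) → U⊒T (P⊆T x∈P) })
                        , U⊒T ∘ T⊒Q

  -- Dependence of sums and integrals on the integrator.

  rsSum-congʳ : ∀ {a b f g h} →
    (∀ {s t} → a ≤ s → s ≤ t → t ≤ b → g t -ᶜ g s ≈ᶜ h t -ᶜ h s) →
    {P : Partition a b} (ξs : Tags P) → rsSum f g ξs ≈ᶜ rsSum f h ξs
  rsSum-congʳ eq [] = ≈ᶜ-refl
  rsSum-congʳ eq (tag {a≤t = a≤t} {P = P} ξ _ _ ξs) =
    +-cong (*-congˡ (eq ≤-refl a≤t (partition-≤ P)))
           (rsSum-congʳ (λ t≤s → eq (≤-trans a≤t t≤s)) ξs)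

  rsSum-+ : ∀ f g h {a b} {P : Partition a b} (ξs : Tags P) →
            rsSum f (λ t → g t +ᶜ h t) ξs ≈ᶜ rsSum f g ξs +ᶜ rsSum f h ξs
  rsSum-+ f g h [] = ≈ᶜ-sym (+-identityˡ 0ᶜ)
  rsSum-+ f g h (tag {a = s} {t = t} ξ _ _ ξs) = begin
    f ξ *ᶜ ((g t +ᶜ h t) -ᶜ (g s +ᶜ h s)) +ᶜ rsSum f (λ t → g t +ᶜ h t) ξs
      ≈⟨ +-congˡ (rsSum-+ f g h ξs) ⟩
    f ξ *ᶜ ((g t +ᶜ h t) -ᶜ (g s +ᶜ h s)) +ᶜ (rsSum f g ξs +ᶜ rsSum f h ξs)
      ≈⟨ solve 7 (λ z gt gs ht hs G H →
           z :* ((gt :+ ht) :- (gs :+ hs)) :+ (G :+ H) := (z :* (gt :- gs) :+ G) :+ (z :* (ht :- hs) :+ H))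
           ≈ᶜ-refl (f ξ) (g t) (g s) (h t) (h s) (rsSum f g ξs) (rsSum f h ξs) ⟩
    (f ξ *ᶜ (g t -ᶜ g s) +ᶜ rsSum f g ξs) +ᶜ (f ξ *ᶜ (h t -ᶜ h s) +ᶜ rsSum f h ξs) ∎

  -- Asks for constancy from `a` on only, so that it also applies to a step function on the part of
  -- a partition past its jump.
  rsSum-const : ∀ f g {a b} → (∀ {t} → a ≤ t → g t ≈ᶜ g a) →
                {P : Partition a b} (ξs : Tags P) → rsSum f g ξs ≈ᶜ 0ᶜ
  rsSum-const f g const [] = ≈ᶜ-refl
  rsSum-const f g {a} const (tag {t = t} {a≤t = a≤t} ξ _ _ ξs) = begin
    f ξ *ᶜ (g t -ᶜ g a) +ᶜ rsSum f g ξs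
      ≈⟨ +-cong (*-congˡ (+-congʳ (const a≤t)))
           (rsSum-const f g (λ t≤s → ≈ᶜ-trans (const (≤-trans a≤t t≤s)) (≈ᶜ-sym (const a≤t))) ξs) ⟩
    f ξ *ᶜ (g a -ᶜ g a) +ᶜ 0ᶜ  ≈⟨ +-identityʳ _ ⟩
    f ξ *ᶜ (g a -ᶜ g a)        ≈⟨ *-congˡ (-‿inverseʳ (g a)) ⟩
    f ξ *ᶜ 0ᶜ                  ≈⟨ zeroʳ (f ξ) ⟩
    0ᶜ                         ∎

  -- Sums see the integrator only through its increments. This lets S be replaced by a finite sum of
  -- steps from which it differs by an additive constant.
  ∫-congʳ : ∀ {a b f g h I} →
    (∀ {s t} → a ≤ s → s ≤ t → t ≤ b → g t -ᶜ g s ≈ᶜ h t -ᶜ h s) →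
    ∫[ a , b ] f d g ≈ I → ∫[ a , b ] f d h ≈ I
  ∫-congʳ eq ∫fdg ε 0<ε with ∫fdg ε 0<ε
  ... | P , close = P , λ Q Q⊒P ξs → ∣∣<-resp-≈ᶜ (+-congʳ (rsSum-congʳ eq ξs)) (close Q Q⊒P ξs)

  ∫-const : ∀ {a b} f z → a ≤ b → ∫[ a , b ] f d (λ _ → z) ≈ 0ᶜ
  ∫-const {a} {b} f z a≤b ε 0<ε = a ∷⟨ a≤b ⟩ [ b ] , λ Q Q⊒P ξs →
    ∣∣<-resp-≈ᶜ (≈ᶜ-sym (≈ᶜ-trans (+-congʳ (rsSum-const f (λ _ → z) (λ _ → ≈ᶜ-refl) ξs)) (-‿inverseʳ 0ᶜ)))
              (∣0∣< 0<ε)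

  ∫-+ : ∀ {a b f g h I J} → ∫[ a , b ] f d g ≈ I → ∫[ a , b ] f d h ≈ J →
        ∫[ a , b ] f d (λ t → g t +ᶜ h t) ≈ (I +ᶜ J)
  ∫-+ {f = f} {g} {h} {I} {J} ∫fdg ∫fdh ε 0<ε with ∃-half 0<ε
  ... | η , 0<η , 2η≈ε with ∫fdg η 0<η | ∫fdh η 0<η
  ...   | P , close-g | P′ , close-h with merge ≤-refl P P′
  ...     | T , T⊒P , T⊒P′ = T , λ Q Q⊒T ξs →
    ∣∣<-resp-≈ 2η≈ε (∣∣<-resp-≈ᶜ (split ξs) (∣+∣< (close-g Q (Q⊒T ∘ T⊒P) ξs) (close-h Q (Q⊒T ∘ T⊒P′) ξs)))
    where
    split : ∀ {Q} (ξs : Tags Q) →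
      (rsSum f g ξs -ᶜ I) +ᶜ (rsSum f h ξs -ᶜ J) ≈ᶜ rsSum f (λ t → g t +ᶜ h t) ξs -ᶜ (I +ᶜ J)
    split ξs = begin
      (rsSum f g ξs -ᶜ I) +ᶜ (rsSum f h ξs -ᶜ J)
        ≈⟨ solve 4 (λ G H I J → (G :- I) :+ (H :- J) := (G :+ H) :- (I :+ J))
             ≈ᶜ-refl (rsSum f g ξs) (rsSum f h ξs) I J ⟩
      (rsSum f g ξs +ᶜ rsSum f h ξs) -ᶜ (I +ᶜ J)       ≈⟨ +-congʳ (rsSum-+ f g h ξs) ⟨
      rsSum f (λ t → g t +ᶜ h t) ξs -ᶜ (I +ᶜ J)        ∎

  -- Summation and integration by parts.

  interleave : ∀ {a b} {P : Partition a b} → Tags P → Partition a b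
  interleave ([] {a})                           = [ a ]
  interleave (tag {a = a} {t = t} ξ a≤ξ ξ≤t ξs) = a ∷⟨ a≤ξ ⟩ ξ ∷⟨ ξ≤t ⟩ interleave ξs

  endpointTags : ∀ {a b} {P : Partition a b} (ξs : Tags P) → Tags (interleave ξs)
  endpointTags []                                 = []
  endpointTags (tag {a = a} {t = t} ξ a≤ξ ξ≤t ξs) =
    tag a ≤-refl a≤ξ (tag t ξ≤t ≤-refl (endpointTags ξs))

  interleave-⊒ : ∀ {a b} {P : Partition a b} (ξs : Tags P) → interleave ξs ⊒ P
  interleave-⊒ []              p         = p
  interleave-⊒ (tag _ _ _ _)   (here p)  = here p
  interleave-⊒ (tag _ _ _ ξs)  (there p) = there (there (interleave-⊒ ξs p))

  -- On one subinterval [a , t] with tag ξ, the three terms g(ξ)(f(t) - f(a)), f(a)(g(ξ) - g(a)) and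
  -- f(t)(g(t) - g(ξ)) add up to f(t)g(t) - f(a)g(a), and these differences telescope.
  rsSum-by-parts : ∀ f g {a b} {P : Partition a b} (ξs : Tags P) →
    rsSum g f ξs +ᶜ rsSum f g (endpointTags ξs) ≈ᶜ f b *ᶜ g b -ᶜ f a *ᶜ g a
  rsSum-by-parts f g ([] {a}) = ≈ᶜ-trans (+-identityˡ 0ᶜ) (≈ᶜ-sym (-‿inverseʳ (f a *ᶜ g a)))
  rsSum-by-parts f g {a} {b} (tag {t = t} ξ _ _ ξs) = begin
    (g ξ *ᶜ (f t -ᶜ f a) +ᶜ G) +ᶜ (f a *ᶜ (g ξ -ᶜ g a) +ᶜ (f t *ᶜ (g t -ᶜ g ξ) +ᶜ F))
      ≈⟨ solve 7 (λ gξ ft fa ga gt G F →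
           (gξ :* (ft :- fa) :+ G) :+ (fa :* (gξ :- ga) :+ (ft :* (gt :- gξ) :+ F))
           := (G :+ F) :+ (ft :* gt :- fa :* ga))
           ≈ᶜ-refl (g ξ) (f t) (f a) (g a) (g t) G F ⟩
    (G +ᶜ F) +ᶜ (f t *ᶜ g t -ᶜ f a *ᶜ g a)
      ≈⟨ +-congʳ (rsSum-by-parts f g ξs) ⟩
    (f b *ᶜ g b -ᶜ f t *ᶜ g t) +ᶜ (f t *ᶜ g t -ᶜ f a *ᶜ g a)
      ≈⟨ solve 3 (λ x y z → (x :- y) :+ (y :- z) := x :- z)
           ≈ᶜ-refl (f b *ᶜ g b) (f t *ᶜ g t) (f a *ᶜ g a) ⟩
    f b *ᶜ g b -ᶜ f a *ᶜ g a ∎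
    where
    G F : ℂ
    G = rsSum g f ξs
    F = rsSum f g (endpointTags ξs)

  -- The error of a sum for ∫ g df is minus the error of the interleaved sum for ∫ f dg.
  -- Interleaving refines `Q` and hence `P`, so the same partition serves with the same ε, and no
  -- continuity is required.
  ∫-by-parts : ∀ {a b f g I} → ∫[ a , b ] f d g ≈ I →
               ∫[ a , b ] g d f ≈ (f b *ᶜ g b -ᶜ f a *ᶜ g a -ᶜ I)
  ∫-by-parts {a} {b} {f} {g} {I} ∫fdg ε 0<ε with ∫fdg ε 0<ε
  ... | P , close = P , λ Q Q⊒P ξs →
    ∣∣<-resp-≈ᶜ (rearrange ξs)
      (∣-∣< (close (interleave ξs) (interleave-⊒ ξs ∘ Q⊒P) (endpointTags ξs)))
    where
    rearrange : ∀ {Q : Partition a b} (ξs : Tags Q) → -ᶜ (rsSum f g (endpointTags ξs) -ᶜ I) ≈ᶜ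
                rsSum g f ξs -ᶜ (f b *ᶜ g b -ᶜ f a *ᶜ g a -ᶜ I)
    rearrange ξs = begin
      -ᶜ (F -ᶜ I)
        ≈⟨ solve 3 (λ F G I → :- (F :- I) := G :- (G :+ F :- I)) ≈ᶜ-refl F G I ⟩
      G -ᶜ (G +ᶜ F -ᶜ I)
        ≈⟨ +-congˡ (-‿cong (+-congʳ (rsSum-by-parts f g ξs))) ⟩
      G -ᶜ (f b *ᶜ g b -ᶜ f a *ᶜ g a -ᶜ I) ∎
      where
      G F : ℂ
      G = rsSum g f ξs
      F = rsSum f g (endpointTags ξs)

  -- Integration against step functions.

  step : ℝ → ℂ → ℝ → ℂ
  step p z t = if does (p ≤? t) then z else 0ᶜ

  step-≥ : ∀ {p z t} → p ≤ t → step p z t ≈ᶜ z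
  step-≥ {p} {t = t} p≤t with p ≤? t
  ... | yes _   = ≈ᶜ-refl
  ... | no  p≰t = contradiction p≤t p≰t

  step-< : ∀ {p z t} → t < p → step p z t ≈ᶜ 0ᶜ
  step-< {p} {t = t} t<p with p ≤? t
  ... | yes p≤t = contradiction p≤t (<⇒≱ t<p)
  ... | no  _   = ≈ᶜ-refl

  -- Only the subinterval ending at p contributes; the point m of the partition
  -- confines the tag of that subinterval to [m , p].
  rsSum-step : ∀ f z {m p s b} {Q : Partition s b} (ξs : Tags Q) →
    s < p → p ≤ b → p ∈ᴿ points Q → m < p → m ≤ s ⊎ m ∈ᴿ points Q →
    ∃ λ ξ → s ≤ ξ × ξ ≤ b × m ≤ ξ × ξ ≤ p × rsSum f (step p z) ξs ≈ᶜ f ξ *ᶜ z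
  rsSum-step f z [] s<p p≤s _ _ _ = contradiction p≤s (<⇒≱ s<p)
  rsSum-step f z {p = p} (tag ξ _ _ _) s<p _ (here p≈s) _ _ = contradiction s<p (<-irrefl (≈-sym p≈s))
  rsSum-step f z {m} {p} {s} (tag {t = t} {a≤t = s≤t} {P = P} ξ s≤ξ ξ≤t ξs) s<p p≤b (there p∈) m<p m∈
    with ≤-<-connex p t
  -- In this case `t` is `p` itself, because `p` occurs among the points from `t` on; this bounds
  -- the tag by `p`.
  ... | inj₁ p≤t = ξ , s≤ξ , ≤-trans ξ≤t (partition-≤ P) , ≤-trans m≤s s≤ξ
                , ≤-trans ξ≤t (points-≥ P p∈) , (begin
      f ξ *ᶜ (step p z t -ᶜ step p z s) +ᶜ rsSum f (step p z) ξs
        ≈⟨ +-cong (*-congˡ (+-cong (step-≥ p≤t) (-‿cong (step-< s<p))))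
             (rsSum-const f (step p z) (λ t≤r → ≈ᶜ-trans (step-≥ (≤-trans p≤t t≤r)) (≈ᶜ-sym (step-≥ p≤t))) ξs) ⟩
      f ξ *ᶜ (z -ᶜ 0ᶜ) +ᶜ 0ᶜ  ≈⟨ +-identityʳ _ ⟩
      f ξ *ᶜ (z -ᶜ 0ᶜ)        ≈⟨ *-congˡ (z-0≈z z) ⟩
      f ξ *ᶜ z                ∎)
    where
    -- Every point after `s` is at least `t`, hence at least `p`, and so cannot be `m`.
    locate : m ≤ s ⊎ m ∈ᴿ points (s ∷⟨ s≤t ⟩ P) → m ≤ s
    locate (inj₁ m≤s)         = m≤s
    locate (inj₂ (here m≈s))  = ≈⇒≤ m≈s
    locate (inj₂ (there m∈P)) = contradiction (≤-trans p≤t (points-≥ P m∈P)) (<⇒≱ m<p)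

    m≤s = locate m∈
  ... | inj₂ t<p with rsSum-step f z ξs t<p p≤b p∈ m<p (weaken m∈)
    where
    weaken : m ≤ s ⊎ m ∈ᴿ points (s ∷⟨ s≤t ⟩ P) → m ≤ t ⊎ m ∈ᴿ points P
    weaken (inj₁ m≤s)         = inj₁ (≤-trans m≤s s≤t)
    weaken (inj₂ (here m≈s))  = inj₁ (≤-trans (≈⇒≤ m≈s) s≤t)
    weaken (inj₂ (there m∈P)) = inj₂ m∈P
  ...   | ξ′ , t≤ξ′ , ξ′≤b , m≤ξ′ , ξ′≤p , eq =
    ξ′ , ≤-trans s≤t t≤ξ′ , ξ′≤b , m≤ξ′ , ξ′≤p , (begin
      f ξ *ᶜ (step p z t -ᶜ step p z s) +ᶜ rsSum f (step p z) ξs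
        ≈⟨ +-cong (*-congˡ (+-cong (step-< (t<p)) (-‿cong (step-< s<p)))) eq ⟩
      f ξ *ᶜ (0ᶜ -ᶜ 0ᶜ) +ᶜ f ξ′ *ᶜ z  ≈⟨ +-congʳ (*-congˡ (-‿inverseʳ 0ᶜ)) ⟩
      f ξ *ᶜ 0ᶜ +ᶜ f ξ′ *ᶜ z          ≈⟨ +-congʳ (zeroʳ (f ξ)) ⟩
      0ᶜ +ᶜ f ξ′ *ᶜ z                 ≈⟨ +-identityˡ _ ⟩
      f ξ′ *ᶜ z                       ∎)

  -- One term f(ξ) z survives, with ξ in [m , p], so the error is (f(ξ) - f(p)) z. Continuity of
  -- multiplication turns ε into a tolerance η for f(ξ) - f(p), and left continuity turns η into δ.
  ∫-step : ∀ {a b f p} z → a < p → p ≤ b → LeftContinuousAt a b f p →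
           ∫[ a , b ] f d (step p z) ≈ (z *ᶜ f p)
  ∫-step {a} {b} {f} {p} z a<p p≤b f-cont ε 0<ε with *ᶜ-continuous z 0<ε
  ... | η , 0<η , *z-small with f-cont η 0<η
  ...   | δ , 0<δ , f-close with near
    where
    -- The point p - δ will not do, as left continuity asks for p - δ < t strictly; a point between
    -- it and p is taken instead. If p - δ lies to the left of a, then a serves.
    near : ∃ λ m → a ≤ m × m < p × (∀ {t} → m ≤ t → a ≤ t → p - δ < t)
    near with ≤-<-connex a (p - δ)
    ... | inj₁ a≤p-δ with dense (x-y<x {p} 0<δ)
    ...   | m , p-δ<m , m<p = m , ≤-trans a≤p-δ (<⇒≤ p-δ<m) , m<p , λ m≤t _ → <-≤-trans p-δ<m m≤t
    near | inj₂ p-δ<a = a , ≤-refl , a<p , λ _ a≤t → <-≤-trans (p-δ<a) a≤t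
  ...     | m , a≤m , m<p , m-near =
    a ∷⟨ a≤m ⟩ m ∷⟨ <⇒≤ m<p ⟩ p ∷⟨ p≤b ⟩ [ b ] , close
    where
    P = a ∷⟨ a≤m ⟩ m ∷⟨ <⇒≤ m<p ⟩ p ∷⟨ p≤b ⟩ [ b ]

    close : (Q : Partition a b) → Q ⊒ P → (ξs : Tags Q) → ∣ rsSum f (step p z) ξs -ᶜ z *ᶜ f p ∣< ε
    close Q Q⊒P ξs
      with rsSum-step f z ξs a<p p≤b (Q⊒P (there (there (here ≈-refl)))) m<p
             (inj₂ (Q⊒P (there (here ≈-refl))))
    ... | ξ , a≤ξ , ξ≤b , m≤ξ , ξ≤p , eq =
      ∣∣<-resp-≈ᶜ (begin
        (f ξ -ᶜ f p) *ᶜ z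
          ≈⟨ solve 3 (λ x y z → (x :- y) :* z := x :* z :- z :* y) ≈ᶜ-refl (f ξ) (f p) z ⟩
        f ξ *ᶜ z -ᶜ z *ᶜ f p                   ≈⟨ +-congʳ eq ⟨
        rsSum f (step p z) ξs -ᶜ z *ᶜ f p      ∎)
        (*z-small _ (f-close ξ a≤ξ ξ≤b (m-near m≤ξ a≤ξ) ξ≤p))

  ∫-∑-step : ∀ {a b f} (Λ : ℤ → ℝ) (coeff : ℤ → ℂ) {ns} → a ≤ b →
    All (λ n → a < Λ n × Λ n ≤ b × LeftContinuousAt a b f (Λ n)) ns →
    ∫[ a , b ] f d (λ t → foldr (λ n z → step (Λ n) (coeff n) t +ᶜ z) 0ᶜ ns)
      ≈ foldr (λ n z → coeff n *ᶜ f (Λ n) +ᶜ z) 0ᶜ ns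
  ∫-∑-step {f = f} Λ coeff a≤b [] = ∫-const f 0ᶜ a≤b
  ∫-∑-step Λ coeff a≤b ((a<Λ , Λ≤b , f-cont) ∷ hyps) =
    ∫-+ (∫-step (coeff _) a<Λ Λ≤b f-cont) (∫-∑-step Λ coeff a≤b hyps)

-- Finite sums over enumerated index sets.

module FiniteSums {c ℓ₁ ℓ₂} (R : CompleteOrderedField c ℓ₁ ℓ₂) where
  open Analysis R
  open ComplexProperties R
  open CommutativeRing ℂ-commutativeRing
    using (+-cong; +-congˡ; +-congʳ; +-identityˡ; -‿inverseʳ)
    renaming (refl to ≈ᶜ-refl; sym to ≈ᶜ-sym; trans to ≈ᶜ-trans; setoid to ℂ-setoid)
  open IntegerSolver ℂ-commutativeRing
  open import Relation.Binary.Reasoning.Setoid ℂ-setoid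
  open Enumeration

  ∑ : List ℤ → (ℤ → ℂ) → ℂ
  ∑ ns g = foldr (λ n z → g n +ᶜ z) 0ᶜ ns

  ∑-minus : ∀ ns g h → ∑ ns (λ n → g n -ᶜ h n) ≈ᶜ ∑ ns g -ᶜ ∑ ns h
  ∑-minus []       g h = ≈ᶜ-sym (-‿inverseʳ 0ᶜ)
  ∑-minus (n ∷ ns) g h = begin
    (g n -ᶜ h n) +ᶜ ∑ ns (λ n → g n -ᶜ h n)  ≈⟨ +-congˡ (∑-minus ns g h) ⟩
    (g n -ᶜ h n) +ᶜ (∑ ns g -ᶜ ∑ ns h)       ≈⟨ solve 4 (λ x y G H →
        (x :- y) :+ (G :- H) := (x :+ G) :- (y :+ H)) ≈ᶜ-refl (g n) (h n) (∑ ns g) (∑ ns h) ⟩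
    (g n +ᶜ ∑ ns g) -ᶜ (h n +ᶜ ∑ ns h)       ∎

  ∑-↭ : ∀ g {ms ns} → ms ↭ ns → ∑ ms g ≈ᶜ ∑ ns g
  ∑-↭ g ↭.refl             = ≈ᶜ-refl
  ∑-↭ g (↭.prep n p)       = +-congˡ (∑-↭ g p)
  ∑-↭ g (↭.swap {xs = ms} {ys = ns} m n p) = begin
    g m +ᶜ (g n +ᶜ ∑ ms g)  ≈⟨ +-congˡ (+-congˡ (∑-↭ g p)) ⟩
    g m +ᶜ (g n +ᶜ ∑ ns g)  ≈⟨ solve 3 (λ x y z → x :+ (y :+ z) := y :+ (x :+ z))
                                 ≈ᶜ-refl (g m) (g n) (∑ ns g) ⟩
    g n +ᶜ (g m +ᶜ ∑ ns g)  ∎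
  ∑-↭ g (↭.trans p q)      = ≈ᶜ-trans (∑-↭ g p) (∑-↭ g q)

  ∑-filter : ∀ {p} {P : Pred ℤ p} (P? : Decidable P) {g h} →
    (∀ n → P n → g n ≈ᶜ h n) → (∀ n → ¬ P n → h n ≈ᶜ 0ᶜ) →
    ∀ ns → ∑ (filter P? ns) g ≈ᶜ ∑ ns h
  ∑-filter P? g≈h h≈0 [] = ≈ᶜ-refl
  ∑-filter P? {g} {h} g≈h h≈0 (n ∷ ns) with P? n
  ... | yes Pn = +-cong (g≈h n Pn) (∑-filter P? g≈h h≈0 ns)
  ... | no ¬Pn = begin
    ∑ (filter P? ns) g  ≈⟨ ∑-filter P? g≈h h≈0 ns ⟩
    ∑ ns h              ≈⟨ +-identityˡ (∑ ns h) ⟨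
    0ᶜ +ᶜ ∑ ns h        ≈⟨ +-congʳ (h≈0 n ¬Pn) ⟨
    h n +ᶜ ∑ ns h       ∎

  -- An enumeration fixes its members but not their order. Two duplicate-free lists with the same
  -- members are permutations of each other, so `E` can be exchanged for the filtered list of `F`,
  -- and the indices filtered out contribute zero to the sum of `h`.
  ∑-extend : ∀ {p q} {P : Pred ℤ p} {Q : Pred ℤ q} (E : Enumeration P) (F : Enumeration Q) →
    Decidable P → (∀ {n} → P n → Q n) → ∀ {g h} →
    (∀ n → P n → g n ≈ᶜ h n) → (∀ n → ¬ P n → h n ≈ᶜ 0ᶜ) →
    ∑[ E ] g ≈ᶜ ∑[ F ] h
  ∑-extend E F P? P⊆Q {g} {h} g≈h h≈0 =
    ≈ᶜ-trans (∑-↭ g E↭filter) (∑-filter P? g≈h h≈0 (elements F))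
    where
    E↭filter : elements E ↭ filter P? (elements F)
    E↭filter = ∼bag⇒↭ (unique∧set⇒bag (unique E) (Unique.filter⁺ P? (unique F)) (mk⇔
      (λ n∈E → ∈-filter⁺ P? (complete F (P⊆Q (sound E n∈E))) (sound E n∈E))
      (λ n∈F → complete E (proj₂ (∈-filter⁻ P? {xs = elements F} n∈F)))))

  ∑-empty : ∀ {p} {P : Pred ℤ p} (E : Enumeration P) g → (∀ n → ¬ P n) → ∑[ E ] g ≈ᶜ 0ᶜ
  ∑-empty E g ¬P with elements E in eq
  ... | []    = ≈ᶜ-refl
  ... | n ∷ _ = contradiction (sound E (≡.subst (n ∈_) (≡.sym eq) (here ≡.refl))) (¬P n)

-- The summatory function as a combination of steps.

module SummatoryFunction {c ℓ₁ ℓ₂} (R : CompleteOrderedField c ℓ₁ ℓ₂)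
  (Λ : ℤ → CompleteOrderedField.Carrier R)
  (Λ→+∞ : Analysis.TendsTo+∞ R Λ) (Λ→-∞ : Analysis.TendsTo-∞ R Λ) where
  open Analysis R
  open Sums Λ Λ→+∞ Λ→-∞
  open OrderedFieldProperties R
    using (≤-refl; ≤-trans; <⇒≤; ≤-<-trans; <⇒≱; ≤-<-connex)
  open ComplexProperties R
  open StieltjesIntegral R using (step; step-≥; step-<)
  open FiniteSums R
  open CommutativeRing ℂ-commutativeRing
    using (+-cong; -‿cong; +-identityˡ; -‿inverseʳ)
    renaming (refl to ≈ᶜ-refl; sym to ≈ᶜ-sym; trans to ≈ᶜ-trans; setoid to ℂ-setoid)
  open IntegerSolver ℂ-commutativeRing
  open import Relation.Binary.Reasoning.Setoid ℂ-setoid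
  open Enumeration

  ∑-range-extend : ∀ {u x y v g h} → u ≤ x → y ≤ v →
    (∀ n → x < Λ n → Λ n ≤ y → g n ≈ᶜ h n) →
    (∀ n → Λ n ≤ x ⊎ y < Λ n → h n ≈ᶜ 0ᶜ) →
    ∑⟨ x <Λ≤ y ⟩ g ≈ᶜ ∑⟨ u <Λ≤ v ⟩ h
  ∑-range-extend {u} {x} {y} {v} {h = h} u≤x y≤v g≈h h≈0 =
    ∑-extend (range x y) (range u v) (λ n → (x <? Λ n) ×-dec (Λ n ≤? y))
      (λ (x<Λ , Λ≤y) → ≤-<-trans u≤x x<Λ , ≤-trans Λ≤y y≤v)
      (λ n (x<Λ , Λ≤y) → g≈h n x<Λ Λ≤y)
      outside
    where
    outside : ∀ n → ¬ (x < Λ n × Λ n ≤ y) → h n ≈ᶜ 0ᶜ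
    outside n n∉ with ≤-<-connex (Λ n) x | ≤-<-connex (Λ n) y
    ... | inj₁ Λ≤x | _        = h≈0 n (inj₁ Λ≤x)
    ... | inj₂ x<Λ | inj₁ Λ≤y = contradiction (x<Λ , Λ≤y) n∉
    ... | inj₂ _   | inj₂ y<Λ = h≈0 n (inj₂ y<Λ)

  -- For u ≤ t ≤ v this is the sum of g(n) over u < Λ(n) ≤ t. Keeping the index set independent of t
  -- exhibits it as a fixed finite combination of step functions.
  ∑-step : ℝ → ℝ → (ℤ → ℂ) → ℝ → ℂ
  ∑-step u v g t = ∑⟨ u <Λ≤ v ⟩ (λ n → step (Λ n) (g n) t)

  -- All of [s , t] lies on one side of the jump.
  step-increment-outside : ∀ {p x y s t} z → x ≤ s → s ≤ t → t ≤ y → p ≤ x ⊎ y < p →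
    step p z t -ᶜ step p z s ≈ᶜ 0ᶜ
  step-increment-outside z x≤s s≤t t≤y (inj₁ p≤x) =
    ≈ᶜ-trans (+-cong (step-≥ (≤-trans p≤x (≤-trans x≤s s≤t))) (-‿cong (step-≥ (≤-trans p≤x x≤s))))
             (-‿inverseʳ z)
  step-increment-outside z x≤s s≤t t≤y (inj₂ y<p) =
    ≈ᶜ-trans (+-cong (step-< (≤-<-trans t≤y y<p)) (-‿cong (step-< (≤-<-trans (≤-trans s≤t t≤y) y<p))))
             (-‿inverseʳ 0ᶜ)

  ∑-step-increment : ∀ {u x s t y v} g → u ≤ x → x ≤ s → s ≤ t → t ≤ y → y ≤ v →
    ∑-step x y g t -ᶜ ∑-step x y g s ≈ᶜ ∑-step u v g t -ᶜ ∑-step u v g s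
  ∑-step-increment {u} {x} {s} {t} {y} {v} g u≤x x≤s s≤t t≤y y≤v = begin
    ∑-step x y g t -ᶜ ∑-step x y g s
      ≈⟨ ∑-minus (elements (range x y)) _ _ ⟨
    ∑⟨ x <Λ≤ y ⟩ (λ n → step (Λ n) (g n) t -ᶜ step (Λ n) (g n) s)
      ≈⟨ ∑-range-extend u≤x y≤v (λ _ _ _ → ≈ᶜ-refl)
           (λ n → step-increment-outside (g n) x≤s s≤t t≤y) ⟩
    ∑⟨ u <Λ≤ v ⟩ (λ n → step (Λ n) (g n) t -ᶜ step (Λ n) (g n) s)
      ≈⟨ ∑-minus (elements (range u v)) _ _ ⟩
    ∑-step u v g t -ᶜ ∑-step u v g s ∎

  -- From x to y a step grows by its full height if its jump lies in (x , y], and not at all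
  -- otherwise.
  ∑-range-step : ∀ {u x y v} g → u ≤ x → x ≤ y → y ≤ v →
    ∑⟨ x <Λ≤ y ⟩ g ≈ᶜ ∑-step u v g y -ᶜ ∑-step u v g x
  ∑-range-step {u} {x} {y} {v} g u≤x x≤y y≤v = begin
    ∑⟨ x <Λ≤ y ⟩ g
      ≈⟨ ∑-range-extend u≤x y≤v
           (λ n x<Λ Λ≤y → ≈ᶜ-sym (begin
             step (Λ n) (g n) y -ᶜ step (Λ n) (g n) x  ≈⟨ +-cong (step-≥ Λ≤y) (-‿cong (step-< x<Λ)) ⟩
             g n -ᶜ 0ᶜ                                 ≈⟨ z-0≈z (g n) ⟩
             g n                                       ∎))
           (λ n → step-increment-outside (g n) ≤-refl x≤y ≤-refl) ⟩
    ∑⟨ u <Λ≤ v ⟩ (λ n → step (Λ n) (g n) y -ᶜ step (Λ n) (g n) x)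
      ≈⟨ ∑-minus (elements (range u v)) _ _ ⟩
    ∑-step u v g y -ᶜ ∑-step u v g x ∎

  ∑-range-empty : ∀ {x y} g → y ≤ x → ∑⟨ x <Λ≤ y ⟩ g ≈ᶜ 0ᶜ
  ∑-range-empty {x} {y} g y≤x =
    ∑-empty (range x y) g λ n (x<Λ , Λ≤y) → <⇒≱ x<Λ (≤-trans Λ≤y y≤x)

  -- The orientation convention in `summatory` gives the same formula on both sides of `λ₀`: one of
  -- its two sums is empty and the other is an increment between `λ₀` and `t`.
  summatory-∑-step : ∀ {u v λ₀ t} g → u ≤ λ₀ → λ₀ ≤ v → u ≤ t → t ≤ v →
    summatory λ₀ g t ≈ᶜ ∑-step u v g t -ᶜ ∑-step u v g λ₀
  summatory-∑-step {u} {v} {λ₀} {t} g u≤λ₀ λ₀≤v u≤t t≤v with ≤-<-connex λ₀ t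
  ... | inj₁ λ₀≤t = begin
    ∑⟨ λ₀ <Λ≤ t ⟩ g -ᶜ ∑⟨ t <Λ≤ λ₀ ⟩ g
      ≈⟨ +-cong (∑-range-step g u≤λ₀ λ₀≤t t≤v) (-‿cong (∑-range-empty g λ₀≤t)) ⟩
    ∑-step u v g t -ᶜ ∑-step u v g λ₀ -ᶜ 0ᶜ  ≈⟨ z-0≈z _ ⟩
    ∑-step u v g t -ᶜ ∑-step u v g λ₀        ∎
  ... | inj₂ t<λ₀ = begin
    ∑⟨ λ₀ <Λ≤ t ⟩ g -ᶜ ∑⟨ t <Λ≤ λ₀ ⟩ g
      ≈⟨ +-cong (∑-range-empty g (<⇒≤ t<λ₀)) (-‿cong (∑-range-step g u≤t (<⇒≤ t<λ₀) λ₀≤v)) ⟩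
    0ᶜ -ᶜ (∑-step u v g λ₀ -ᶜ ∑-step u v g t)  ≈⟨ +-identityˡ _ ⟩
    -ᶜ (∑-step u v g λ₀ -ᶜ ∑-step u v g t)
      ≈⟨ solve 2 (λ x y → :- (x :- y) := y :- x) ≈ᶜ-refl (∑-step u v g λ₀) (∑-step u v g t) ⟩
    ∑-step u v g t -ᶜ ∑-step u v g λ₀          ∎

  lower-bound : ∀ x y → ∃ λ u → u ≤ x × u ≤ y
  lower-bound x y with ≤-<-connex x y
  ... | inj₁ x≤y = x , ≤-refl , x≤y
  ... | inj₂ y<x = y , <⇒≤ y<x , ≤-refl

  upper-bound : ∀ x y → ∃ λ v → x ≤ v × y ≤ v
  upper-bound x y with ≤-<-connex x y
  ... | inj₁ x≤y = y , x≤y , ≤-refl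
  ... | inj₂ y<x = x , ≤-refl , <⇒≤ y<x

  -- The base point may lie outside [a , b]. Both sides are therefore compared with a step sum `T`
  -- over a range that contains a, b and `λ₀`, where the constant `T λ₀` cancels.
  summatory-increment : ∀ {a s t b} λ₀ g → a ≤ s → s ≤ t → t ≤ b →
    ∑-step a b g t -ᶜ ∑-step a b g s ≈ᶜ summatory λ₀ g t -ᶜ summatory λ₀ g s
  summatory-increment {a} {s} {t} {b} λ₀ g a≤s s≤t t≤b
    with lower-bound a λ₀ | upper-bound b λ₀
  ... | u , u≤a , u≤λ₀ | v , b≤v , λ₀≤v = begin
    ∑-step a b g t -ᶜ ∑-step a b g s
      ≈⟨ ∑-step-increment g u≤a a≤s s≤t t≤b b≤v ⟩
    T t -ᶜ T s
      ≈⟨ solve 3 (λ x y z → x :- y := (x :- z) :- (y :- z)) ≈ᶜ-refl (T t) (T s) (T λ₀) ⟩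
    (T t -ᶜ T λ₀) -ᶜ (T s -ᶜ T λ₀)
      ≈⟨ +-cong (summatory-∑-step g u≤λ₀ λ₀≤v (≤-trans u≤a (≤-trans a≤s s≤t)) (≤-trans t≤b b≤v))
           (-‿cong (summatory-∑-step g u≤λ₀ λ₀≤v (≤-trans u≤a a≤s) (≤-trans (≤-trans s≤t t≤b) b≤v))) ⟨
    summatory λ₀ g t -ᶜ summatory λ₀ g s ∎
    where
    T : ℝ → ℂ
    T = ∑-step u v g

lemma1 : ∀ {c ℓ₁ ℓ₂} (R : CompleteOrderedField c ℓ₁ ℓ₂) →
    let open Analysis R in
    (Λ : ℤ → ℝ) → StrictlyIncreasing Λ →
    (Λ→+∞ : TendsTo+∞ Λ) (Λ→-∞ : TendsTo-∞ Λ) →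
    let open Sums Λ Λ→+∞ Λ→-∞ in
    (a b : ℝ) → a ≤ b →
    (f : ℝ → ℂ) → WellDefinedOn a b f →
    (∀ n → a < Λ n → Λ n ≤ b → LeftContinuousAt a b f (Λ n)) →
    (coeff : ℤ → ℂ) (λ₀ : ℝ) →
    let S = summatory λ₀ coeff in
    ∃₂ λ I J →
    (∫[ a , b ] f d S ≈ I) ×
    (∫[ a , b ] S d f ≈ J) ×
    (∑⟨ a <Λ≤ b ⟩ (λ n → coeff n *ᶜ f (Λ n)) ≈ᶜ I) ×
    (I ≈ᶜ f b *ᶜ S b -ᶜ f a *ᶜ S a -ᶜ J)
lemma1 R Λ _ Λ→+∞ Λ→-∞ a b a≤b f _ f-cont coeff λ₀ =
  -- Taking for J the value that integration by parts delivers makes the last equation a ring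
  -- identity.
  I , boundary -ᶜ I , ∫fdS , ∫-by-parts ∫fdS , ≈ᶜ-refl
    , solve 2 (λ I B → I := B :- (B :- I)) ≈ᶜ-refl I boundary
  where
  open Analysis R
  open Sums Λ Λ→+∞ Λ→-∞
  open ComplexProperties R using (ℂ-commutativeRing)
  open CommutativeRing ℂ-commutativeRing using () renaming (refl to ≈ᶜ-refl)
  open IntegerSolver ℂ-commutativeRing
  open StieltjesIntegral R
  open SummatoryFunction R Λ Λ→+∞ Λ→-∞

  S : ℝ → ℂ
  S = summatory λ₀ coeff

  I boundary : ℂ
  I = ∑⟨ a <Λ≤ b ⟩ (λ n → coeff n *ᶜ f (Λ n))
  boundary = f b *ᶜ S b -ᶜ f a *ᶜ S a

  ∫fdS : ∫[ a , b ] f d S ≈ I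
  ∫fdS = ∫-congʳ (summatory-increment λ₀ coeff)
    (∫-∑-step Λ coeff a≤b (All.tabulate λ n∈ →
      let a<Λ , Λ≤b = Enumeration.sound (range a b) n∈ in a<Λ , Λ≤b , f-cont _ a<Λ Λ≤b))
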